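{- Let $\mathbf A$ be a Pavelka algebra and $\exists\colon A\to A$ a closure operator, and put $\forall(x)=\neg\exists(\neg x)$. Then $(\mathbf A,\exists)$ is a monadic Pavelka algebra if and only if $(\mathbf A,\forall,\forall)$ is a tense Pavelka algebra.
   Context: An MV-algebra $(A;\oplus,\neg,0)$ carries derived operations $1=\neg0$, $x\cdot y=\neg(\neg x\oplus\neg y)$, $x\rightarrow y=\neg x\oplus y$, lattice operations $\vee,\wedge$ of the order $x\le y$ iff $\neg x\oplus y=1$. A Pavelka algebra is $\mathbf A=(A;\oplus,\neg,\{\mathbf r\mid r\in[0,1]\cap\mathbb Q\})$ with $(A;\oplus,\neg,\mathbf 0)$ an MV-algebra, $\mathbf r\oplus\mathbf s=\mathbf t$ whenever $\min\{r+s,1\}=t$, and $\neg\mathbf r=\mathbf s$ whenever $1-r=s$. A closure operator is a monotone $C$ with $x\le C(x)$, $C(C(x))=C(x)$. A monadic Pavelka algebra is a pair $(\mathbf A,\exists)$ with $\exists$ a closure operator on $A$ such that $\exists(\neg\exists(x))=\neg\exists(x)$ and $\mathbf r\cdot\exists(x)=\exists(\mathbf r\cdot x)$ for all $x\in A$ and constants $\mathbf r$. A tense Pavelka algebra is $(\mathbf A,G,H)$ with $G,H\colon A\to A$ such that for all $x,y$ and constants $\mathbf r$: (PT1) $G(x\wedge y)=G(x)\wedge G(y)$, $H(x\wedge y)=H(x)\wedge H(y)$; (PT2) $\mathbf r\rightarrow G(x)=G(\mathbf r\rightarrow x)$, $\mathbf r\rightarrow H(x)=H(\mathbf r\rightarrow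 x)$; (PT3) $\neg H(\neg G(x))\le x$, $\neg G(\neg H(x))\le x$. -}

module Defs where

open import Algebra.Core using (Op₁; Op₂)
import Algebra.Definitions as AlgebraDefinitions
open import Algebra.Structures using (IsCommutativeMonoid)
open import Data.Product.Base using (_,_)
open import Data.Rational as ℚ using (ℚ; 0ℚ; 1ℚ)
import Data.Rational.Properties as ℚ
open import Level using (Level; suc; _⊔_)
open import Relation.Binary.Bundles using (Setoid)
open import Relation.Binary.Core using (Rel)
open import Relation.Binary.Definitions using (Monotonic₁)
open import Relation.Binary.Lattice.Structures using (IsLattice)
open import Relation.Binary.PropositionalEquality using (_≡_)
import Relation.Binary.Reasoning.Setoid as SetoidReasoning
open import Relation.Binary.Structures using (IsPartialOrder)

private
  variable
    a ℓ : Level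

record IsMVAlgebra {A : Set a} (_≈_ : Rel A ℓ)
                   (_⊕_ : Op₂ A) (¬_ : Op₁ A) (0# : A) : Set (a ⊔ ℓ) where
  infixl 7 _·_
  infixr 6 _∧_
  infixr 5 _∨_
  infixr 4 _⇒_
  infix  3 _≤_

  open AlgebraDefinitions _≈_

  field
    ⊕-isCommutativeMonoid : IsCommutativeMonoid _≈_ _⊕_ 0#
    ¬-cong                : Congruent₁ ¬_
    ¬-involutive          : Involutive ¬_
    ⊕-zeroʳ               : RightZero (¬ 0#) _⊕_
    łukasiewicz           : ∀ x y → ((¬ ((¬ x) ⊕ y)) ⊕ y) ≈ ((¬ ((¬ y) ⊕ x)) ⊕ x)

  open IsCommutativeMonoid ⊕-isCommutativeMonoid public
    using (isEquivalence; setoid; refl; sym; trans)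
    renaming ( ∙-cong to ⊕-cong; ∙-congˡ to ⊕-congˡ; ∙-congʳ to ⊕-congʳ
             ; assoc to ⊕-assoc; comm to ⊕-comm
             ; identityˡ to ⊕-identityˡ; identityʳ to ⊕-identityʳ )

  1# : A
  1# = ¬ 0#

  _·_ : Op₂ A
  x · y = ¬ ((¬ x) ⊕ (¬ y))

  _⇒_ : Op₂ A
  x ⇒ y = (¬ x) ⊕ y

  _≤_ : Rel A ℓ
  x ≤ y = ((¬ x) ⊕ y) ≈ 1#

  -- The lattice operations of _≤_ (see isLattice below).
  _∨_ : Op₂ A
  x ∨ y = (¬ ((¬ x) ⊕ y)) ⊕ y

  _∧_ : Op₂ A
  x ∧ y = ¬ ((¬ x) ∨ (¬ y))

  private
    open module R = SetoidReasoning setoid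

    ¬1≈0 : (¬ 1#) ≈ 0#
    ¬1≈0 = ¬-involutive 0#

    ¬x⊕x≈1 : ∀ x → ((¬ x) ⊕ x) ≈ 1#
    ¬x⊕x≈1 x = begin
      (¬ x) ⊕ x               ≈⟨ ⊕-congʳ (¬-cong (⊕-identityˡ x)) ⟨
      (¬ (0# ⊕ x)) ⊕ x        ≈⟨ ⊕-congʳ (¬-cong (⊕-congʳ ¬1≈0)) ⟨
      (¬ ((¬ 1#) ⊕ x)) ⊕ x    ≈⟨ łukasiewicz 1# x ⟩
      (¬ ((¬ x) ⊕ 1#)) ⊕ 1#   ≈⟨ ⊕-zeroʳ _ ⟩
      1#                      ∎

    ≤-reflexive : ∀ {x y} → x ≈ y → x ≤ y
    ≤-reflexive {x} {y} x≈y = trans (⊕-congʳ (¬-cong x≈y)) (¬x⊕x≈1 y)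

    ≤-respʳ : ∀ {x y z} → y ≈ z → x ≤ y → x ≤ z
    ≤-respʳ y≈z x≤y = trans (⊕-congˡ (sym y≈z)) x≤y

    ≤-respˡ : ∀ {x y z} → x ≈ y → x ≤ z → y ≤ z
    ≤-respˡ x≈y x≤z = trans (⊕-congʳ (¬-cong (sym x≈y))) x≤z

    y≤x⊕y : ∀ x y → y ≤ (x ⊕ y)
    y≤x⊕y x y = begin
      (¬ y) ⊕ (x ⊕ y)   ≈⟨ ⊕-comm _ _ ⟩
      (x ⊕ y) ⊕ (¬ y)   ≈⟨ ⊕-assoc _ _ _ ⟩
      x ⊕ (y ⊕ (¬ y))   ≈⟨ ⊕-congˡ (⊕-comm _ _) ⟩
      x ⊕ ((¬ y) ⊕ y)   ≈⟨ ⊕-congˡ (¬x⊕x≈1 y) ⟩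
      x ⊕ 1#            ≈⟨ ⊕-zeroʳ x ⟩
      1#                ∎

    x≤y⇒x∨y≈y : ∀ {x y} → x ≤ y → (x ∨ y) ≈ y
    x≤y⇒x∨y≈y {x} {y} x≤y = begin
      (¬ ((¬ x) ⊕ y)) ⊕ y   ≈⟨ ⊕-congʳ (¬-cong x≤y) ⟩
      (¬ 1#) ⊕ y            ≈⟨ ⊕-congʳ ¬1≈0 ⟩
      0# ⊕ y                ≈⟨ ⊕-identityˡ y ⟩
      y                     ∎

    ∨-comm : ∀ x y → (x ∨ y) ≈ (y ∨ x)
    ∨-comm = łukasiewicz

    ≤-decompose : ∀ {x y} → x ≤ y → ((¬ ((¬ y) ⊕ x)) ⊕ x) ≈ y
    ≤-decompose {x} {y} x≤y = trans (∨-comm y x) (x≤y⇒x∨y≈y x≤y)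

    ≤-antisym : ∀ {x y} → x ≤ y → y ≤ x → x ≈ y
    ≤-antisym {x} {y} x≤y y≤x = trans (sym (≤-decompose y≤x)) (x≤y⇒x∨y≈y x≤y)

    ≤-trans : ∀ {x y z} → x ≤ y → y ≤ z → x ≤ z
    ≤-trans {x} {y} {z} x≤y y≤z = ≤-respʳ eq (y≤x⊕y _ x)
      where
      eq : (((¬ ((¬ z) ⊕ y)) ⊕ (¬ ((¬ y) ⊕ x))) ⊕ x) ≈ z
      eq = trans (⊕-assoc _ _ _) (trans (⊕-congˡ (≤-decompose x≤y)) (≤-decompose y≤z))

    ⊕-monoˡ : ∀ {x y} z → x ≤ y → (x ⊕ z) ≤ (y ⊕ z)
    ⊕-monoˡ z x≤y =
      ≤-respʳ (trans (sym (⊕-assoc _ _ _)) (⊕-congʳ (≤-decompose x≤y))) (y≤x⊕y _ _)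

    ¬-anti : ∀ {x y} → x ≤ y → (¬ y) ≤ (¬ x)
    ¬-anti {x} {y} x≤y = trans (⊕-congʳ (¬-involutive y)) (trans (⊕-comm _ _) x≤y)

    y≤x∨y : ∀ x y → y ≤ (x ∨ y)
    y≤x∨y x y = y≤x⊕y _ y

    x≤x∨y : ∀ x y → x ≤ (x ∨ y)
    x≤x∨y x y = ≤-respʳ (∨-comm y x) (y≤x∨y y x)

    ∨-least : ∀ {x y z} → x ≤ z → y ≤ z → (x ∨ y) ≤ z
    ∨-least {x} {y} {z} x≤z y≤z =
      ≤-respʳ (≤-decompose y≤z) (⊕-monoˡ y (¬-anti (⊕-monoˡ y (¬-anti x≤z))))

  isPartialOrder : IsPartialOrder _≈_ _≤_
  isPartialOrder = record
    { isPreorder = record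
      { isEquivalence = isEquivalence
      ; reflexive     = ≤-reflexive
      ; trans         = ≤-trans
      }
    ; antisym = ≤-antisym
    }

  isLattice : IsLattice _≈_ _≤_ _∨_ _∧_
  isLattice = record
    { isPartialOrder = isPartialOrder
    ; supremum       = λ x y → x≤x∨y x y , y≤x∨y x y , λ _ → ∨-least
    ; infimum        = λ x y →
          ≤-respʳ (¬-involutive x) (¬-anti (x≤x∨y (¬ x) (¬ y)))
        , ≤-respʳ (¬-involutive y) (¬-anti (y≤x∨y (¬ x) (¬ y)))
        , λ z z≤x z≤y →
            ≤-respˡ (¬-involutive z) (¬-anti (∨-least (¬-anti z≤x) (¬-anti z≤y)))
    }

record Unitℚ : Set where
  constructor ⟨_⟩
  field
    value   : ℚ
    .{0≤value} : 0ℚ ℚ.≤ value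
    .{value≤1} : value ℚ.≤ 1ℚ

open Unitℚ public using (value)

0ᵤ : Unitℚ
0ᵤ = ⟨ 0ℚ ⟩ {ℚ.≤-refl} {ℚ.nonNegative⁻¹ 1ℚ}

record PavelkaAlgebra (a ℓ : Level) : Set (suc (a ⊔ ℓ)) where
  infix  8 ¬_
  infixl 6 _⊕_
  infix  2 _≈_
  field
    Carrier     : Set a
    _≈_         : Rel Carrier ℓ
    _⊕_         : Op₂ Carrier
    ¬_          : Op₁ Carrier
    const       : Unitℚ → Carrier
    isMVAlgebra : IsMVAlgebra _≈_ _⊕_ ¬_ (const 0ᵤ)
    const-⊕     : ∀ r s t → (value r ℚ.+ value s) ℚ.⊓ 1ℚ ≡ value t →
                  const r ⊕ const s ≈ const t
    const-¬     : ∀ r s → 1ℚ ℚ.- value r ≡ value s → ¬ const r ≈ const s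

  open IsMVAlgebra isMVAlgebra public

module _ (𝐀 : PavelkaAlgebra a ℓ) where
  open PavelkaAlgebra 𝐀
  open AlgebraDefinitions _≈_ using (Congruent₁; IdempotentFun)

  -- Compatibility with _≈_ follows from monotonicity and antisymmetry of _≤_.
  record IsClosureOperator (C : Op₁ Carrier) : Set (a ⊔ ℓ) where
    field
      mono       : Monotonic₁ _≤_ _≤_ C
      extensive  : ∀ x → x ≤ C x
      idempotent : IdempotentFun C

  record IsMonadicPavelkaAlgebra (∃ : Op₁ Carrier) : Set (a ⊔ ℓ) where
    field
      isClosureOperator : IsClosureOperator ∃
      ∃-¬∃              : ∀ x → ∃ (¬ ∃ x) ≈ ¬ ∃ x
      const-·-∃         : ∀ r x → const r · ∃ x ≈ ∃ (const r · x)

  record IsTensePavelkaAlgebra (G H : Op₁ Carrier) : Set (a ⊔ ℓ) where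
    field
      -- G and H are operations on the setoid (Carrier, _≈_).
      G-cong : Congruent₁ G
      H-cong : Congruent₁ H
      PT1-G  : ∀ x y → G (x ∧ y) ≈ G x ∧ G y
      PT1-H  : ∀ x y → H (x ∧ y) ≈ H x ∧ H y
      PT2-G  : ∀ r x → const r ⇒ G x ≈ G (const r ⇒ x)
      PT2-H  : ∀ r x → const r ⇒ H x ≈ H (const r ⇒ x)
      PT3-H  : ∀ x → ¬ H (¬ G x) ≤ x
      PT3-G  : ∀ x → ¬ G (¬ H x) ≤ x

  dual : Op₁ Carrier → Op₁ Carrier
  dual ∃ x = ¬ ∃ (¬ x)

{-# OPTIONS --safe #-}
-- Both sides say that ∃ is left adjoint to ∀ = ¬∃¬ and that ∃ commutes with
-- r · _ (dually, ∀ with r ⇒ _).  The unit law x ≤ ∀∃x is immediate from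
-- ∃¬∃x ≈ ¬∃x, and a right adjoint preserves meets.  Conversely, the counit
-- ∃∀y ≤ y at y = ∀¬x gives ∃¬∃x ≤ ¬∃x, as ∀ is idempotent.
module Submission where

open import Defs
open import Algebra.Core using (Op₁)
open import Function.Bundles using (_⇔_; mk⇔)
open import Relation.Binary.Definitions using (Monotonic₁)
open import Relation.Binary.Lattice.Structures using (IsLattice)

module _ {a ℓ} (𝐀 : PavelkaAlgebra a ℓ) where
  open PavelkaAlgebra 𝐀
  open IsLattice isLattice
    using (∧-greatest; x∧y≤x; x∧y≤y; antisym)
    renaming (reflexive to ≤-reflexive; trans to ≤-trans)

  ¬-antitone : ∀ {x y} → x ≤ y → ¬ y ≤ ¬ x
  ¬-antitone x≤y = trans (⊕-congʳ (¬-involutive _)) (trans (⊕-comm _ _) x≤y)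

  ¬x≤y⇒¬y≤x : ∀ {x y} → ¬ x ≤ y → ¬ y ≤ x
  ¬x≤y⇒¬y≤x ¬x≤y = ≤-trans (¬-antitone ¬x≤y) (≤-reflexive (¬-involutive _))

  module _ {∃ : Op₁ Carrier} (isClosureOperator : IsClosureOperator 𝐀 ∃) where
    open IsClosureOperator isClosureOperator

    private
      A : Op₁ Carrier
      A = dual 𝐀 ∃

    ∃-cong : ∀ {x y} → x ≈ y → ∃ x ≈ ∃ y
    ∃-cong x≈y = antisym (mono (≤-reflexive x≈y)) (mono (≤-reflexive (sym x≈y)))

    dual-cong : ∀ {x y} → x ≈ y → A x ≈ A y
    dual-cong x≈y = ¬-cong (∃-cong (¬-cong x≈y))

    dual-mono : Monotonic₁ _≤_ _≤_ A
    dual-mono x≤y = ¬-antitone (mono (¬-antitone x≤y))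

    dual-contractive : ∀ x → A x ≤ x
    dual-contractive x = ¬x≤y⇒¬y≤x (extensive (¬ x))

    dual-idempotent : ∀ x → A (A x) ≈ A x
    dual-idempotent x =
      ¬-cong (trans (∃-cong (¬-involutive _)) (idempotent (¬ x)))

    dual-¬ : ∀ x → A (¬ x) ≈ ¬ ∃ x
    dual-¬ x = ¬-cong (∃-cong (¬-involutive x))

    -- Taken at `A x`, this identifies the left side of PT3 with `∃ (A x)`: for `G = H = A`, PT3 is
    -- the counit law.
    ¬-dual-¬ : ∀ x → ¬ A (¬ x) ≈ ∃ x
    ¬-dual-¬ x = trans (¬-cong (dual-¬ x)) (¬-involutive _)

    monadic⇒tense : IsMonadicPavelkaAlgebra 𝐀 ∃ → IsTensePavelkaAlgebra 𝐀 A A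
    monadic⇒tense monadic = record
      { G-cong = dual-cong
      ; H-cong = dual-cong
      ; PT1-G  = dual-∧
      ; PT1-H  = dual-∧
      ; PT2-G  = const-⇒-dual
      ; PT2-H  = const-⇒-dual
      ; PT3-H  = counit
      ; PT3-G  = counit
      }
      where
      open IsMonadicPavelkaAlgebra monadic using (∃-¬∃; const-·-∃)

      ∃-dual≤ : ∀ x → ∃ (A x) ≤ x
      -- `A x` is itself of the form `¬ ∃ _`, so `∃` fixes it.
      ∃-dual≤ x = ≤-trans (≤-reflexive (∃-¬∃ (¬ x))) (dual-contractive x)

      counit : ∀ x → ¬ A (¬ A x) ≤ x
      counit x = ≤-trans (≤-reflexive (¬-dual-¬ (A x))) (∃-dual≤ x)

      unit : ∀ x → x ≤ A (∃ x)
      unit x = ≤-trans (extensive x)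
        (≤-reflexive (sym (trans (¬-cong (∃-¬∃ x)) (¬-involutive _))))

      transpose : ∀ {x y} → ∃ x ≤ y → x ≤ A y
      transpose ∃x≤y = ≤-trans (unit _) (dual-mono ∃x≤y)

      dual-∧ : ∀ x y → A (x ∧ y) ≈ A x ∧ A y
      dual-∧ x y = antisym
        (∧-greatest (dual-mono (x∧y≤x x y)) (dual-mono (x∧y≤y x y)))
        -- By adjointness it suffices that `∃ (A x ∧ A y)` lies below both `x` and `y`.
        (transpose (∧-greatest
          (≤-trans (mono (x∧y≤x (A x) (A y))) (∃-dual≤ x))
          (≤-trans (mono (x∧y≤y (A x) (A y))) (∃-dual≤ y))))

      const-⇒-dual : ∀ r x → const r ⇒ A x ≈ A (const r ⇒ x)
      -- `¬ (const r ⇒ A x)` unfolds to `const r · ∃ (¬ x)`, which brings in the monadic law at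
      -- `¬ x`.
      const-⇒-dual r x = trans (sym (¬-involutive _))
        (¬-cong (trans (const-·-∃ r (¬ x))
          (∃-cong (¬-cong (⊕-congˡ (¬-involutive x))))))

    tense⇒monadic : IsTensePavelkaAlgebra 𝐀 A A → IsMonadicPavelkaAlgebra 𝐀 ∃
    tense⇒monadic tense = record
      { isClosureOperator = isClosureOperator
      ; ∃-¬∃              = λ x → antisym (∃-¬∃≤ x) (extensive (¬ ∃ x))
      ; const-·-∃         = λ r x →
          -- `const r · x` unfolds to `¬ (const r ⇒ ¬ x)`, so PT2 at `¬ x` leaves only a double
          -- negation in front of `∃ (const r · x)`.
          trans (¬-cong (trans (⊕-congˡ (sym (dual-¬ x))) (PT2-G r (¬ x))))
                (¬-involutive _)
      }
      where
      open IsTensePavelkaAlgebra tense using (PT2-G; PT3-H)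

      ∃-dual≤ : ∀ x → ∃ (A x) ≤ x
      ∃-dual≤ x = ≤-trans (≤-reflexive (sym (¬-dual-¬ (A x)))) (PT3-H x)

      ∃-¬∃≤ : ∀ x → ∃ (¬ ∃ x) ≤ ¬ ∃ x
      ∃-¬∃≤ x = ≤-trans
        -- Writing `¬ ∃ x` as `A (A (¬ x))` lets the counit remove the outer `A`; the inner one
        -- restores `¬ ∃ x`.
        (≤-reflexive (∃-cong (sym (trans (dual-idempotent (¬ x)) (dual-¬ x)))))
        (≤-trans (∃-dual≤ (A (¬ x))) (≤-reflexive (dual-¬ x)))

theorem14 : ∀ {a ℓ} (𝐀 : PavelkaAlgebra a ℓ) (∃ : PavelkaAlgebra.Carrier 𝐀 → PavelkaAlgebra.Carrier 𝐀) →
    IsClosureOperator 𝐀 ∃ →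
    IsMonadicPavelkaAlgebra 𝐀 ∃ ⇔ IsTensePavelkaAlgebra 𝐀 (dual 𝐀 ∃) (dual 𝐀 ∃)
theorem14 𝐀 ∃ C = mk⇔ (monadic⇒tense 𝐀 C) (tense⇒monadic 𝐀 C)
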